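{- Let $\mathcal{H}_2$ be the family of all subgraphs of the hexagonal grids $H_{m,n}$, over all positive integers $m,n$. Then the oriented chromatic number of this family satisfies $\chi_o(\mathcal{H}_2) \ge 6$.
   Context: All graphs are finite simple graphs or orientations of such graphs. An orientation $\vec{G}$ of a simple graph $G$ is a digraph obtained from $G$ by assigning to each edge exactly one of its two possible directions; $A(\vec{G})$ denotes its set of arcs. A digraph obtained in this way is called an oriented graph. An oriented $k$-coloring of an oriented graph $\vec{G}$ is a homomorphism from $\vec{G}$ to some orientation $\vec{K}_k$ of the complete graph $K_k$ (a tournament on $k$ vertices), i.e. a function $\phi: V(\vec{G}) \to V(\vec{K}_k)$ such that $(u,v)\in A(\vec{G})$ implies $(\phi(u),\phi(v))\in A(\vec{K}_k)$. The oriented chromatic number $\chi_o(\vec{G})$ of an oriented graph $\vec{G}$ is the minimum $k$ for which $\vec{G}$ has an oriented $k$-coloring. The oriented chromatic number $\chi_o(G)$ of an unoriented graph $G$ is the maximum of $\chi_o(\vec{G})$ over all orientations $\vec{G}$ of $G$. For a family $\mathcal{F}$ of graphs, $\chi_o(\mathcal{F}) = \max\{\chi_o(G) \mid G\in\mathcal{F}\}$. The square grid $S(m,n)$ is the graph with vertices $v_{i,j}$, $1\le i\le m$, $1\le j\le n$, whose edges are all pairs $\{v_{i,j},v_{i,j+1}\}$ and $\{v_{i,j},v_{i+1,j}\}$ with both endpoints in the vertex set. The hexagonal grid $H_{m,n}$ ($m$ rows of $n$ hexagons) is the subgraph of $S(m+1,2n+m)$ whose vertices are exactly the vertices $v_{i,j}$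 of $S(m+1,2n+m)$ satisfying $i-1\le j\le i+2n$, and whose edges are all edges $\{v_{i,j},v_{i,j+1}\}$ between such vertices, together with the edges $\{v_{i,j},v_{i+1,j}\}$ between such vertices for which $i+j$ is even. $\mathcal{H}_2$ denotes the set of all (not necessarily induced) subgraphs of $H_{m,n}$, for all positive integers $m$ and $n$. -}

module Defs where

open import Data.Fin using (Fin; zero; suc; toℕ)
import Data.Fin.Properties as Fin
open import Data.Nat using (ℕ; zero; suc; _+_; _*_; _∸_; _≤_; _≤?_; _≟_; NonZero)
open import Data.Nat.Divisibility using (_∣_; _∣?_)
open import Data.Nat.Properties using (≤-trans; ≤-irrelevant; 1+n≢n)
open import Data.Product using (Σ; ∃-syntax; _×_; _,_; proj₁; proj₂)
open import Data.Product.Function.Dependent.Propositional using (Σ-↔)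
open import Data.Sum using (_⊎_; inj₁; inj₂)
open import Data.Sum.Function.Propositional using (_⊎-↔_)
open import Function using (_↔_; mk↔ₛ′; _⇔_; mk⇔; _on_; _∘_)
open import Function.Bundles using (Inverse)
open import Function.Definitions using (Injective)
open import Function.Properties.Inverse using (↔-refl; ↔-sym; ↔-trans)
open import Level using (Level; 0ℓ)
open import Relation.Binary using (Rel; Decidable; Symmetric; Irreflexive; Asymmetric)
open import Relation.Binary.Construct.Closure.Symmetric using (SymClosure; fwd; bwd; symmetric)
open import Relation.Binary.PropositionalEquality
  using (_≡_; _≢_; refl; sym; cong₂; ≢-sym)
open import Relation.Nullary using (¬_; Dec; yes; no; Irrelevant; contradiction)
open import Relation.Nullary.Decidable using (_×-dec_; _⊎-dec_; ¬?)

private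
  variable
    ℓ : Level

Finite : Set → Set
Finite A = ∃[ n ] (A ↔ Fin n)

Dec⇒Finite : {P : Set} → Irrelevant P → Dec P → Finite P
Dec⇒Finite irr (yes p) =
  1 , mk↔ₛ′ (λ _ → zero) (λ _ → p) (λ { zero → refl }) (λ q → irr p q)
Dec⇒Finite irr (no ¬p) =
  0 , mk↔ₛ′ (λ p → contradiction p ¬p) (λ ()) (λ ()) (λ p → contradiction p ¬p)

private
  Σ-suc : ∀ {n} (B : Fin (suc n) → Set) →
          Σ (Fin (suc n)) B ↔ (B zero ⊎ Σ (Fin n) (B ∘ suc))
  Σ-suc B = mk↔ₛ′
    (λ { (zero , b) → inj₁ b ; (suc i , b) → inj₂ (i , b) })
    (λ { (inj₁ b) → zero , b ; (inj₂ (i , b)) → suc i , b })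
    (λ { (inj₁ _) → refl ; (inj₂ _) → refl })
    (λ { (zero , _) → refl ; (suc _ , _) → refl })

  Σ-Fin : ∀ n (B : Fin n → Set) → (∀ i → Finite (B i)) → Finite (Σ (Fin n) B)
  Σ-Fin zero    B fin = 0 , mk↔ₛ′ proj₁ (λ ()) (λ ()) (λ ())
  Σ-Fin (suc n) B fin with fin zero | Σ-Fin n (B ∘ suc) (fin ∘ suc)
  ... | a , f | b , g =
    a + b , ↔-trans (Σ-suc B) (↔-trans (f ⊎-↔ g) (↔-sym Fin.+↔⊎))

Σ-Finite : {A : Set} {B : A → Set} → Finite A → (∀ x → Finite (B x)) → Finite (Σ A B)
Σ-Finite {B = B} (n , f) fin with Σ-Fin n (B ∘ Inverse.from f) (fin ∘ Inverse.from f)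
... | k , g = k , ↔-trans (↔-sym (Σ-↔ (↔-sym f) ↔-refl)) g

record Graph : Set₁ where
  infix 4 _~_ _~?_
  field
    V        : Set
    finite   : Finite V
    _~_      : Rel V 0ℓ
    _~?_     : Decidable _~_
    ~-sym    : Symmetric _~_
    ~-irrefl : Irreflexive _≡_ _~_

record Orientation (G : Graph) : Set₁ where
  open Graph G
  field
    Arc      : Rel V 0ℓ
    arc⇒edge : ∀ {u v} → Arc u v → u ~ v
    edge⇒arc : ∀ {u v} → u ~ v → Arc u v ⊎ Arc v u
    asym     : Asymmetric Arc

-- G is isomorphic to a (not necessarily induced) subgraph of H.
infix 4 _⊑_
record _⊑_ (G H : Graph) : Set where
  private
    module G = Graph G
    module H = Graph H
  field
    embed     : G.V → H.V
    injective : Injective _≡_ _≡_ embed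
    edge      : ∀ {u v} → u G.~ v → embed u H.~ embed v

record Hom {G H : Graph} (G⃗ : Orientation G) (H⃗ : Orientation H) : Set where
  private
    module G⃗ = Orientation G⃗
    module H⃗ = Orientation H⃗
  field
    map : Graph.V G → Graph.V H
    arc : ∀ {u v} → G⃗.Arc u v → H⃗.Arc (map u) (map v)

complete : ℕ → Graph
complete k = record
  { V        = Fin k
  ; finite   = k , ↔-refl
  ; _~_      = _≢_
  ; _~?_     = λ i j → ¬? (i Fin.≟ j)
  ; ~-sym    = ≢-sym
  ; ~-irrefl = λ i≡j i≢j → i≢j i≡j
  }

Tournament : ℕ → Set₁
Tournament k = Orientation (complete k)

OrientedColoring : {G : Graph} → Orientation G → ℕ → Set₁
OrientedColoring G⃗ k = Σ (Tournament k) (Hom G⃗)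

IsMinimum IsMaximum : (ℕ → Set ℓ) → ℕ → Set ℓ
IsMinimum P k = P k × (∀ {j} → P j → k ≤ j)
IsMaximum P k = P k × (∀ {j} → P j → j ≤ k)

Isχₒ⃗ : {G : Graph} → Orientation G → ℕ → Set₁
Isχₒ⃗ G⃗ = IsMinimum (OrientedColoring G⃗)

Isχₒ : Graph → ℕ → Set₁
Isχₒ G = IsMaximum (λ k → Σ (Orientation G) (λ G⃗ → Isχₒ⃗ G⃗ k))

Family : Set₂
Family = Graph → Set₁

IsFamilyχₒ : Family → ℕ → Set₁
IsFamilyχₒ 𝓕 = IsMaximum (λ k → Σ Graph (λ G → 𝓕 G × Isχₒ G k))

-- A family may be infinite, so its maximum need not exist.  The lower bound
-- n ≤ χₒ(𝓕) is therefore the existence of a member G with n ≤ χₒ(G);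
-- `≤χₒ⇔≤` shows that this agrees with n ≤ k whenever χₒ(𝓕) = k.
infix 4 _≤χₒ_
_≤χₒ_ : ℕ → Family → Set₁
n ≤χₒ 𝓕 = Σ Graph (λ G → 𝓕 G × ∃[ k ] (Isχₒ G k × n ≤ k))

≤χₒ⇔≤ : ∀ {𝓕 n k} → IsFamilyχₒ 𝓕 k → (n ≤χₒ 𝓕) ⇔ (n ≤ k)
≤χₒ⇔≤ ((G , G∈𝓕 , χG≡k) , max) = mk⇔
  (λ { (G′ , G′∈𝓕 , j , χG′≡j , n≤j) → ≤-trans n≤j (max (G′ , G′∈𝓕 , χG′≡j)) })
  (λ n≤k → G , G∈𝓕 , _ , χG≡k , n≤k)

Cell : ℕ → ℕ → Set
Cell m n = Fin m × Fin n

-- Rows and columns are numbered from 1, to match the index bounds in InHex.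
row col : ∀ {m n} → Cell m n → ℕ
row (i , _) = suc (toℕ i)
col (_ , j) = suc (toℕ j)

Right Down : ∀ {m n} → Rel (Cell m n) 0ℓ
Right u v = row v ≡ row u × col v ≡ suc (col u)
Down  u v = row v ≡ suc (row u) × col v ≡ col u

squareStep hexStep : ∀ {m n} → Rel (Cell m n) 0ℓ
squareStep u v = Right u v ⊎ Down u v
hexStep    u v = Right u v ⊎ (Down u v × 2 ∣ row u + col u)

squareStep? : ∀ {m n} → Decidable (squareStep {m} {n})
squareStep? u v = (row v ≟ row u ×-dec col v ≟ suc (col u))
            ⊎-dec (row v ≟ suc (row u) ×-dec col v ≟ col u)

hexStep? : ∀ {m n} → Decidable (hexStep {m} {n})
hexStep? u v = (row v ≟ row u ×-dec col v ≟ suc (col u))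
         ⊎-dec ((row v ≟ suc (row u) ×-dec col v ≟ col u) ×-dec 2 ∣? (row u + col u))

squareStep-irrefl : ∀ {m n} {u : Cell m n} → ¬ squareStep u u
squareStep-irrefl (inj₁ (_ , c)) = 1+n≢n (sym c)
squareStep-irrefl (inj₂ (r , _)) = 1+n≢n (sym r)

hexStep⇒squareStep : ∀ {m n} {u v : Cell m n} → hexStep u v → squareStep u v
hexStep⇒squareStep (inj₁ r)       = inj₁ r
hexStep⇒squareStep (inj₂ (d , _)) = inj₂ d

private
  symClosure? : {A : Set} {R : Rel A 0ℓ} → Decidable R → Decidable (SymClosure R)
  symClosure? R? u v with R? u v | R? v u
  ... | yes r | _     = yes (fwd r)
  ... | no _  | yes r = yes (bwd r)
  ... | no ¬r | no ¬s = no λ { (fwd r) → ¬r r ; (bwd s) → ¬s s }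

  symClosure-irrefl : {A : Set} {R : Rel A 0ℓ} →
                      (∀ {u} → ¬ R u u) → Irreflexive _≡_ (SymClosure R)
  symClosure-irrefl ¬r refl (fwd r) = ¬r r
  symClosure-irrefl ¬r refl (bwd r) = ¬r r

  Cell-Finite : ∀ m n → Finite (Cell m n)
  Cell-Finite m n = m * n , ↔-sym Fin.*↔×

squareGrid : ℕ → ℕ → Graph
squareGrid m n = record
  { V        = Cell m n
  ; finite   = Cell-Finite m n
  ; _~_      = SymClosure squareStep
  ; _~?_     = symClosure? squareStep?
  ; ~-sym    = symmetric squareStep
  ; ~-irrefl = symClosure-irrefl squareStep-irrefl
  }

-- Truncated subtraction is harmless here: row v ≥ 1.
InHex : ∀ n {p q} → Cell p q → Set
InHex n v = row v ∸ 1 ≤ col v × col v ≤ row v + 2 * n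

InHex-Finite : ∀ n {p q} (v : Cell p q) → Finite (InHex n v)
InHex-Finite n v = Dec⇒Finite
  (λ (a , b) (c , d) → cong₂ _,_ (≤-irrelevant a c) (≤-irrelevant b d))
  ((row v ∸ 1 ≤? col v) ×-dec (col v ≤? row v + 2 * n))

HexVertex : ℕ → ℕ → Set
HexVertex m n = Σ (Cell (m + 1) (2 * n + m)) (InHex n)

hexGrid : ℕ → ℕ → Graph
hexGrid m n = record
  { V        = HexVertex m n
  ; finite   = Σ-Finite (Cell-Finite (m + 1) (2 * n + m)) (InHex-Finite n)
  ; _~_      = SymClosure (hexStep on proj₁)
  ; _~?_     = symClosure? (λ u v → hexStep? (proj₁ u) (proj₁ v))
  ; ~-sym    = symmetric (hexStep on proj₁)
  ; ~-irrefl = symClosure-irrefl (squareStep-irrefl ∘ hexStep⇒squareStep)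
  }

hexGrid⊑squareGrid : ∀ m n → hexGrid m n ⊑ squareGrid (m + 1) (2 * n + m)
hexGrid⊑squareGrid m n = record
  { embed     = proj₁
  ; injective = λ { {_ , a , b} {_ , c , d} refl →
                    cong₂ (λ x y → _ , x , y) (≤-irrelevant a c) (≤-irrelevant b d) }
  ; edge      = λ { (fwd s) → fwd (hexStep⇒squareStep s)
                  ; (bwd s) → bwd (hexStep⇒squareStep s) }
  }

data ℋ₂ (G : Graph) : Set₁ where
  subgraph : ∀ m n → .{{NonZero m}} → .{{NonZero n}} → G ⊑ hexGrid m n → ℋ₂ G

{-# OPTIONS --safe #-}

-- χₒ of a finite graph is a maximum of minima over finite sets, so it exists,
-- and it suffices to orient one hexagonal grid without an oriented 5-coloring.
-- By Rédei's theorem the target tournament may be taken to contain the path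
-- 0 → 1 → 2 → 3 → 4, which leaves 64 tournaments.  For each of them, the set of
-- colorings of one column of a four-row grid that extend to all earlier columns
-- is propagated from column to column; for a suitable orientation, found by
-- computer search, it becomes empty within 22 steps for all 64 tournaments.

module Submission where

open import Data.Bool using (Bool; true; false; if_then_else_; T; not)
open import Data.Fin using
  ( Fin; zero; suc; toℕ; fromℕ; inject₁; inject≤; _<_; _↑ˡ_; _↑ʳ_
  ; combine; remQuot; finToFun; funToFin )
open import Data.Fin.Patterns using (0F; 1F; 2F; 3F; 4F)
import Data.Fin.Properties as Fin
open import Data.List using (List; []; _∷_; allFin; drop; foldr; head; lookup)
open import Data.List.Membership.Propositional using (_∈_)
open import Data.List.Membership.Propositional.Properties using (∈-allFin)
open import Data.List.Relation.Binary.Permutation.Propositional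
  using (_↭_; prep; swap; ↭-refl; ↭-sym; ↭-trans)
open import Data.List.Relation.Binary.Permutation.Propositional.Properties
  using (∈-resp-↭; ↭-length)
import Data.List.Relation.Unary.All as All
open import Data.List.Relation.Unary.Any using (index; here; there)
open import Data.List.Relation.Unary.Any.Properties using (lookup-index)
open import Data.List.Relation.Unary.Linked using (Linked; []; [-]; _∷_)
open import Data.Maybe using (fromMaybe)
open import Data.Nat using
  (ℕ; zero; suc; _+_; _*_; _∸_; _^_; _/_; _%_; _≤_; z≤n; s≤s; _≡ᵇ_; _≟_)
open import Data.Nat.Divisibility using (_∣_; m%n≡0⇒n∣m)
import Data.Nat.Properties as ℕ
open import Data.List.Extrema ℕ.≤-totalOrder using (argmax; f[xs]≤f[argmax])
open import Data.Product using (Σ; ∃; ∃-syntax; _×_; _,_; proj₁; proj₂)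
open import Data.Sum as Sum using (_⊎_; inj₁; inj₂; [_,_]′)
open import Data.Unit using (tt)
open import Data.Vec as Vec using (Vec; []; _∷_; replicate; tabulate; zipWith)
open import Data.Vec.Properties using (lookup∘tabulate; lookup-replicate; lookup-zipWith)
open import Function using (_∘_)
open import Function.Bundles using (Inverse; Injection)
open import Function.Properties.Inverse using (↔⇒↣)
open import Level using (Level; 0ℓ)
open import Relation.Binary using (Rel; Decidable; Asymmetric; tri<; tri≈; tri>)
  renaming (_⇒_ to _⊆_)
open import Relation.Binary.Construct.Closure.Symmetric using (fwd; bwd)
open import Relation.Binary.PropositionalEquality
  using (_≡_; refl; sym; trans; cong; cong₂; subst; subst₂)
open import Relation.Nullary using (¬_; Dec; yes; no; contradiction)
open import Relation.Nullary.Decidable using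
  ( _×-dec_; ¬?; does; dec-true; dec-false; fromWitness; fromWitnessFalse
  ; map′; toWitness; ⌊_⌋ )
import Relation.Unary as U

open import Defs

private
  variable
    ℓ : Level
    A : Set
    k n : ℕ
    G : Graph

-- Existence of the oriented chromatic number

least : (P : ℕ → Set ℓ) → U.Decidable P → P n → ∃ (IsMinimum P)
least P P? p with P? zero
... | yes p₀ = zero , p₀ , λ _ → z≤n
least {n = zero}  P P? p | no ¬p₀ = contradiction p ¬p₀
least {n = suc n} P P? p | no ¬p₀ with least (P ∘ suc) (P? ∘ suc) p
... | k , pₖ , min = suc k , pₖ , minimal
  where
  minimal : ∀ {j} → P j → suc k ≤ j
  minimal {zero}  p₀ = contradiction p₀ ¬p₀
  minimal {suc j} pⱼ = s≤s (min pⱼ)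

finiteAny? : Finite A → {P : A → Set} → U.Decidable P → Dec (∃ P)
finiteAny? (n , A↔Fin) {P} P? =
  map′ (λ (i , p) → from i , p)
       (λ (x , p) → to x , subst P (sym (strictlyInverseʳ x)) p)
       (Fin.any? (P? ∘ from))
  where open Inverse A↔Fin

asymmetric? : {R : Rel (Fin k) 0ℓ} → Decidable R → Dec (Asymmetric R)
asymmetric? R? =
  map′ (λ asym {i} {j} r s → asym i j (r , s)) (λ asym i j (r , s) → asym r s)
       (Fin.all? λ i → Fin.all? λ j → ¬? (R? i j ×-dec R? j i))

-- Pairs left open by an asymmetric relation are directed upwards.
Completion : Rel (Fin k) 0ℓ → Rel (Fin k) 0ℓ
Completion R i j = R i j ⊎ (¬ R j i × i < j)

completion : {R : Rel (Fin k) 0ℓ} → Decidable R → Asymmetric R → Tournament k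
completion {R = R} R? R-asym = record
  { Arc      = Completion R
  ; arc⇒edge = λ { a refl → asym a a }
  ; edge⇒arc = total
  ; asym     = asym
  }
  where
  asym : Asymmetric (Completion R)
  asym (inj₁ r)          (inj₁ s)          = R-asym r s
  asym (inj₁ r)          (inj₂ (¬r , _))   = ¬r r
  asym (inj₂ (¬s , _))   (inj₁ s)          = ¬s s
  asym (inj₂ (_ , i<j))  (inj₂ (_ , j<i))  = Fin.<-asym i<j j<i

  total : ∀ {i j} → ¬ i ≡ j → Completion R i j ⊎ Completion R j i
  total {i} {j} i≢j with R? i j | R? j i | Fin.<-cmp i j
  ... | yes r | _     | _            = inj₁ (inj₁ r)
  ... | no _  | yes s | _            = inj₂ (inj₁ s)
  ... | no _  | no ¬s | tri< i<j _ _ = inj₁ (inj₂ (¬s , i<j))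
  ... | no _  | no _  | tri≈ _ i≡j _ = contradiction i≡j i≢j
  ... | no ¬r | no _  | tri> _ _ j<i = inj₂ (inj₂ (¬r , j<i))

module _ {G : Graph} (G⃗ : Orientation G) where
  open Graph G
  open Orientation G⃗

  arc? : Decidable Arc
  arc? u v with u ~? v
  ... | no ¬e = no (¬e ∘ arc⇒edge)
  ... | yes e with edge⇒arc e
  ...   | inj₁ a = yes a
  ...   | inj₂ b = no (asym b)

  -- This removes the tournament from the search: `f` is a coloring into some tournament exactly
  -- when `Image f` is asymmetric, since `completion` directs the remaining pairs. Only finitely
  -- many maps are left to try.
  Image : (V → Fin k) → Rel (Fin k) 0ℓ
  Image f i j = ∃[ u ] ∃[ v ] (Arc u v × f u ≡ i × f v ≡ j)

  image? : (f : V → Fin k) → Decidable (Image f)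
  image? f i j = finiteAny? finite λ u → finiteAny? finite λ v →
    arc? u v ×-dec f u Fin.≟ i ×-dec f v Fin.≟ j

  coloring : (f : V → Fin k) → Asymmetric (Image f) → OrientedColoring G⃗ k
  coloring f asym = completion (image? f) asym , record
    { map = f ; arc = λ a → inj₁ (_ , _ , a , refl , refl) }

  -- Agreement is asked for pointwise because a map recovered from its numeric code matches the
  -- original only pointwise.
  coloring-asym : {f : V → Fin k} (c : OrientedColoring G⃗ k) →
                  (∀ v → f v ≡ Hom.map (proj₂ c) v) → Asymmetric (Image f)
  coloring-asym (K⃗ , h) f≗h (u , v , a , refl , refl) (u′ , v′ , a′ , p , q) =
    Orientation.asym K⃗ (Hom.arc h a)
      (subst₂ (Orientation.Arc K⃗)
        (trans (sym (f≗h u′)) (trans p (f≗h v))) (trans (sym (f≗h v′)) (trans q (f≗h u)))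
        (Hom.arc h a′))

  coloring? : ∀ k → Dec (OrientedColoring G⃗ k)
  coloring? k = map′ decoded encoded (Fin.any? λ c → asymmetric? (image? (decode c)))
    where
    open Inverse (proj₂ finite) using (to; from; strictlyInverseʳ)

    decode : Fin (k ^ proj₁ finite) → V → Fin k
    decode c = finToFun c ∘ to

    decoded : (∃[ c ] Asymmetric (Image (decode c))) → OrientedColoring G⃗ k
    decoded (c , asym) = coloring (decode c) asym

    encoded : OrientedColoring G⃗ k → ∃[ c ] Asymmetric (Image (decode c))
    encoded c = funToFin (f ∘ from) , coloring-asym c λ v →
      trans (Fin.finToFun-funToFin (f ∘ from) (to v)) (cong f (strictlyInverseʳ v))
      where f = Hom.map (proj₂ c)

  coloring-mono : ∀ {j} → j ≤ k → OrientedColoring G⃗ j → OrientedColoring G⃗ k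
  coloring-mono j≤k c = coloring (λ v → inject≤ (Hom.map (proj₂ c) v) j≤k)
    λ { (u , v , a , refl , refl) (u′ , v′ , a′ , p , q) →
        coloring-asym c (λ _ → refl) (u , v , a , refl , refl)
          (u′ , v′ , a′ , inj p , inj q) }
    where
    inj : ∀ {x y} → inject≤ x j≤k ≡ inject≤ y j≤k → x ≡ y
    inj = Fin.inject≤-injective j≤k j≤k _ _

  -- Giving every vertex its own color provides the bound up to which `least` searches.
  coloring-injective : OrientedColoring G⃗ (proj₁ finite)
  coloring-injective = coloring to
    λ { (u , v , a , refl , refl) (u′ , v′ , a′ , p , q) →
        asym a (subst₂ Arc (injective p) (injective q) a′) }
    where
    open Inverse (proj₂ finite) using (to)
    open Injection (↔⇒↣ (proj₂ finite)) using (injective)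

  abstract
    χₒ⃗-exists : ∃ (Isχₒ⃗ G⃗)
    χₒ⃗-exists = least _ coloring? coloring-injective

-- A coloring of `H⃗` is also one of `G⃗`. Inclusion of arcs stands in for equality of orientations,
-- which a decoded orientation need not satisfy as a record.
Isχₒ⃗-⊆ : {G⃗ H⃗ : Orientation G} {j : ℕ} →
          Orientation.Arc G⃗ ⊆ Orientation.Arc H⃗ →
          Isχₒ⃗ G⃗ j → Isχₒ⃗ H⃗ k → j ≤ k
Isχₒ⃗-⊆ G⊆H (_ , min) ((K⃗ , h) , _) =
  min (K⃗ , record { map = Hom.map h ; arc = λ a → Hom.arc h (G⊆H a) })

-- Enumeration of the orientations of a graph

module _ (G : Graph) where
  open Graph G
  private
    N : ℕ
    N = proj₁ finite
    open Inverse (proj₂ finite) using (to; from; strictlyInverseʳ)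
    open Injection (↔⇒↣ (proj₂ finite)) using (injective)

  -- A Boolean matrix b, coded as a number, is read as the asymmetric relation
  -- b i j ∧ ¬ b j i.
  private
    R : Fin (2 ^ (N * N)) → Rel (Fin N) 0ℓ
    R c i j = entry i j ≡ suc zero × entry j i ≡ zero
      where
      entry : Fin N → Fin N → Fin 2
      entry i j = finToFun c (combine i j)

    R? : ∀ c → Decidable (R c)
    R? c i j = (_ Fin.≟ _) ×-dec (_ Fin.≟ _)

    R-asym : ∀ c → Asymmetric (R c)
    R-asym c (p , _) (_ , q) with trans (sym p) q
    ... | ()

  -- Every code yields an orientation, because `completion` settles the edges on which the matrix is
  -- silent. The maximum can therefore range over all codes.
  decode : Fin (2 ^ (N * N)) → Orientation G
  decode c = record
    { Arc      = λ u v → u ~ v × K.Arc (to u) (to v)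
    ; arc⇒edge = proj₁
    ; edge⇒arc = λ e → [ inj₁ ∘ (e ,_) , inj₂ ∘ (~-sym e ,_) ]′
                   (K.edge⇒arc (λ eq → ~-irrefl (injective eq) e))
    ; asym     = λ (_ , a) (_ , b) → K.asym a b
    }
    where module K = Orientation (completion (R? c) (R-asym c))

  module _ (G⃗ : Orientation G) where
    open Orientation G⃗

    private
      bit : V → V → Fin 2
      bit u v = if does (arc? G⃗ u v) then suc zero else zero

      bit-yes : ∀ {u v} → Arc u v → bit u v ≡ suc zero
      bit-yes {u} {v} a = cong (if_then suc zero else zero) (dec-true (arc? G⃗ u v) a)

      bit-no : ∀ {u v} → ¬ Arc u v → bit u v ≡ zero
      bit-no {u} {v} ¬a = cong (if_then suc zero else zero) (dec-false (arc? G⃗ u v) ¬a)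

      table : Fin (N * N) → Fin 2
      table x = bit (from (proj₁ (remQuot {N} N x))) (from (proj₂ (remQuot {N} N x)))

      entry : ∀ u v → finToFun (funToFin table) (combine (to u) (to v)) ≡ bit u v
      entry u v = trans (Fin.finToFun-funToFin table _)
        (cong₂ bit
          (trans (cong (from ∘ proj₁) (Fin.remQuot-combine (to u) (to v))) (strictlyInverseʳ u))
          (trans (cong (from ∘ proj₂) (Fin.remQuot-combine (to u) (to v))) (strictlyInverseʳ v)))

    encode : Fin (2 ^ (N * N))
    encode = funToFin table

    ⊆-decode : Arc ⊆ Orientation.Arc (decode encode)
    ⊆-decode {u} {v} a = arc⇒edge a , inj₁
      ( trans (entry u v) (bit-yes a) , trans (entry v u) (bit-no (asym a)) )

  -- χₒ is the maximum over the finitely many codes, of which encode G⃗ is one.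
  χₒ-exists : Orientation G → ∃[ k ] Isχₒ G k
  χₒ-exists G⃗ = χ best , (decode best , proj₂ (χₒ⃗-exists (decode best))) , maximal
    where
    χ : Fin (2 ^ (N * N)) → ℕ
    χ c = proj₁ (χₒ⃗-exists (decode c))

    best : Fin (2 ^ (N * N))
    best = argmax χ (encode G⃗) (allFin _)

    maximal : ∀ {j} → Σ (Orientation G) (λ H⃗ → Isχₒ⃗ H⃗ j) → j ≤ χ best
    maximal (H⃗ , χH≡j) = ℕ.≤-trans
      (Isχₒ⃗-⊆ {G⃗ = H⃗} {decode (encode H⃗)} (⊆-decode H⃗) χH≡j
        (proj₂ (χₒ⃗-exists (decode (encode H⃗)))))
      (All.lookup (f[xs]≤f[argmax] {f = χ} (encode G⃗) (allFin _)) (∈-allFin (encode H⃗)))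

-- By `coloring-mono` the minimum for `G⃗` cannot be at most `n`, and the maximum over all
-- orientations is at least that minimum.
≤χₒ-intro : {G : Graph} (G⃗ : Orientation G) {𝓕 : Family} → 𝓕 G →
            ¬ OrientedColoring G⃗ n → suc n ≤χₒ 𝓕
≤χₒ-intro {G = G} G⃗ G∈𝓕 uncolorable = intro (χₒ-exists G G⃗) (χₒ⃗-exists G⃗)
  where
  intro : ∃[ k ] Isχₒ G k → ∃ (Isχₒ⃗ G⃗) → _
  intro (k , χG≡k) (j , χG⃗≡j) = G , G∈𝓕 , k , χG≡k , ℕ.≤-trans
    (ℕ.≰⇒> (λ j≤n → uncolorable (coloring-mono G⃗ j≤n (proj₁ χG⃗≡j))))
    (proj₂ χG≡k (G⃗ , χG⃗≡j))

-- Rédei normal form of tournaments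

module _ {R : Rel A 0ℓ} (R? : Decidable R) (R-asym : Asymmetric R) where

  Unbeaten : Rel A 0ℓ
  Unbeaten x y = ¬ R y x

  private
    -- `x` goes just before the first element that does not beat it. Each element passed over beats
    -- `x`, so asymmetry gives the link to `x`. The head `y` stays fixed, which preserves the link
    -- from whatever precedes it.
    insert-after : ∀ x {y ys} → ¬ R x y → Linked Unbeaten (y ∷ ys) →
                   ∃[ zs ] (Linked Unbeaten (y ∷ zs) × zs ↭ x ∷ ys)
    insert-after x {ys = []} ¬xy [-] = x ∷ [] , ¬xy ∷ [-] , ↭-refl
    insert-after x {ys = z ∷ zs} ¬xy (¬zy ∷ l) with R? z x
    ... | no ¬zx = x ∷ z ∷ zs , ¬xy ∷ ¬zx ∷ l , ↭-refl
    ... | yes zx with insert-after x (R-asym zx) l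
    ...   | ws , l′ , p = z ∷ ws , ¬zy ∷ l′ , ↭-trans (prep z p) (swap z x ↭-refl)

    insert : ∀ x {ys} → Linked Unbeaten ys → ∃[ zs ] (Linked Unbeaten zs × zs ↭ x ∷ ys)
    insert x [] = x ∷ [] , [-] , ↭-refl
    insert x {y ∷ ys} l with R? y x
    ... | no ¬yx = x ∷ y ∷ ys , ¬yx ∷ l , ↭-refl
    ... | yes yx with insert-after x (R-asym yx) l
    ...   | zs , l′ , p = y ∷ zs , l′ , ↭-trans (prep y p) (swap y x ↭-refl)

  -- Rédei's theorem: for a tournament, Unbeaten is the reflexive closure of R,
  -- so the result is a Hamiltonian path.
  rédei : ∀ xs → ∃[ ys ] (Linked Unbeaten ys × ys ↭ xs)
  rédei []       = [] , [] , ↭-refl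
  rédei (x ∷ xs) with rédei xs
  ... | ys , l , p with insert x l
  ...   | zs , l′ , q = zs , l′ , ↭-trans q (prep x p)

Matrix : Set
Matrix = Vec (Vec Bool 5) 5

-- The superdiagonal carries the Hamiltonian path; the parameters are the pairs 02, 03, 04, 13, 14,
-- 24 in this order.
standard : (p q r s t u : Bool) → Matrix
standard p q r s t u =
    (false ∷ true  ∷ p     ∷ q     ∷ r     ∷ [])
  ∷ (false ∷ false ∷ true  ∷ s     ∷ t     ∷ [])
  ∷ (not p ∷ false ∷ false ∷ true  ∷ u     ∷ [])
  ∷ (not q ∷ not s ∷ false ∷ false ∷ true  ∷ [])
  ∷ (not r ∷ not t ∷ not u ∷ false ∷ false ∷ [])
  ∷ []

infix 4 _[_,_]
_[_,_] : Matrix → Fin 5 → Fin 5 → Bool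
M [ x , y ] = Vec.lookup (Vec.lookup M x) y

module _ {R : Rel (Fin 5) 0ℓ} (R? : Decidable R) (R-asym : Asymmetric R) where

  Standardized : Set
  Standardized = ∃[ p ] ∃[ q ] ∃[ r ] ∃[ s ] ∃[ t ] ∃[ u ] Σ (Fin 5 → Fin 5) λ π →
    ∀ {x y} → R x y → T (standard p q r s t u [ π x , π y ])

  standardize : Standardized
  standardize with rédei R? R-asym (allFin 5)
  ... | ys , l , perm with ↭-length perm
  -- The length equation forces exactly five entries, and the four negations are the links of the
  -- path. A color is renamed to its position on the path.
  standardize | a ∷ b ∷ c ∷ d ∷ e ∷ [] , ¬ba ∷ ¬cb ∷ ¬dc ∷ ¬ed ∷ [-] , perm | refl =
    ⌊ R? a c ⌋ , ⌊ R? a d ⌋ , ⌊ R? a e ⌋ , ⌊ R? b d ⌋ , ⌊ R? b e ⌋ , ⌊ R? c e ⌋ ,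
    position , λ {x} {y} r →
      entry (position x) (position y)
            (subst₂ R (lookup-index (occurs x)) (lookup-index (occurs y)) r)
    where
    ys = a ∷ b ∷ c ∷ d ∷ e ∷ []

    occurs : ∀ x → x ∈ ys
    occurs x = ∈-resp-↭ (↭-sym perm) (∈-allFin x)

    position : Fin 5 → Fin 5
    position x = index (occurs x)

    irrefl : ∀ {x} → ¬ R x x
    irrefl r = R-asym r r

    M = standard ⌊ R? a c ⌋ ⌊ R? a d ⌋ ⌊ R? a e ⌋ ⌊ R? b d ⌋ ⌊ R? b e ⌋ ⌊ R? c e ⌋

    entry : ∀ i j → R (lookup ys i) (lookup ys j) → T (M [ i , j ])
    entry 0F 0F r = irrefl r
    entry 0F 1F r = tt
    entry 0F 2F r = fromWitness r
    entry 0F 3F r = fromWitness r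
    entry 0F 4F r = fromWitness r
    entry 1F 0F r = ¬ba r
    entry 1F 1F r = irrefl r
    entry 1F 2F r = tt
    entry 1F 3F r = fromWitness r
    entry 1F 4F r = fromWitness r
    entry 2F 0F r = fromWitnessFalse (R-asym r)
    entry 2F 1F r = ¬cb r
    entry 2F 2F r = irrefl r
    entry 2F 3F r = tt
    entry 2F 4F r = fromWitness r
    entry 3F 0F r = fromWitnessFalse (R-asym r)
    entry 3F 1F r = fromWitnessFalse (R-asym r)
    entry 3F 2F r = ¬dc r
    entry 3F 3F r = irrefl r
    entry 3F 4F r = tt
    entry 4F 0F r = fromWitnessFalse (R-asym r)
    entry 4F 1F r = fromWitnessFalse (R-asym r)
    entry 4F 2F r = fromWitnessFalse (R-asym r)
    entry 4F 3F r = ¬ed r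
    entry 4F 4F r = irrefl r

-- Propagation of colorings from column to column

-- Sets of words as tries.  Cutting off subtrees as ∅ is optional, so the empty
-- set has several representations.
infix 4 _∈ₛ_
data Sub : ℕ → Set where
  ∅    : Sub n
  ε    : Sub 0
  node : Vec (Sub n) 5 → Sub (suc n)

data _∈ₛ_ : Vec (Fin 5) n → Sub n → Set where
  ε    : [] ∈ₛ ε
  node : ∀ {x} {xs : Vec (Fin 5) n} {Ss} → xs ∈ₛ Vec.lookup Ss x → (x ∷ xs) ∈ₛ node Ss

empty? : (S : Sub n) → Dec (∀ xs → ¬ xs ∈ₛ S)
empty? ∅         = yes λ _ ()
empty? ε         = no λ empty → empty [] ε
empty? {suc n} (node Ss) = map′
  (λ { empty (x ∷ xs) (node p) → empty x xs p })
  (λ empty x xs p → empty (x ∷ xs) (node p))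
  (Fin.all? λ x → empty? (Vec.lookup Ss x))

full : ∀ n → Sub n
full zero    = ε
full (suc n) = node (replicate 5 (full n))

∈-full : (xs : Vec (Fin 5) n) → xs ∈ₛ full n
∈-full []       = ε
∈-full (x ∷ xs) = node (subst (xs ∈ₛ_) (sym (lookup-replicate x _)) (∈-full xs))

infixr 6 _∪_
_∪_ : Sub n → Sub n → Sub n
∅       ∪ S       = S
S       ∪ ∅       = S
ε       ∪ ε       = ε
_∪_ {suc n} (node Ss) (node Ss′) = node (zipWith _∪_ Ss Ss′)

∈-∪ˡ : ∀ {xs : Vec (Fin 5) n} {S S′} → xs ∈ₛ S → xs ∈ₛ S ∪ S′
∈-∪ˡ {S′ = ∅} ε = ε
∈-∪ˡ {S′ = ε} ε = ε
∈-∪ˡ {S′ = ∅} (node p) = node p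
∈-∪ˡ {S′ = node Ss′} (node {x = x} {Ss = Ss} p) =
  node (subst (_ ∈ₛ_) (sym (lookup-zipWith _∪_ x Ss Ss′)) (∈-∪ˡ p))

∈-∪ʳ : ∀ {xs : Vec (Fin 5) n} {S S′} → xs ∈ₛ S′ → xs ∈ₛ S ∪ S′
∈-∪ʳ {S = ∅} p = p
∈-∪ʳ {S = ε} ε = ε
∈-∪ʳ {S = node Ss} (node {x = x} {Ss = Ss′} p) =
  node (subst (_ ∈ₛ_) (sym (lookup-zipWith _∪_ x Ss Ss′)) (∈-∪ʳ {S = Vec.lookup Ss x} p))

-- One number for each of the columns 4, …, 25.  From the right, bits 0–3 tell
-- for rows 1–4 whether the edge from the previous column points to the right,
-- and bits 4–6 tell for rows 1–3 whether the edge to the next row, if there is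
-- one, points down.
codes : List ℕ
codes = 0b0100011 ∷ 0b1010101 ∷ 0b0101110 ∷ 0b0011100 ∷ 0b0101110 ∷ 0b0001010
      ∷ 0b0101010 ∷ 0b0000011 ∷ 0b0000101 ∷ 0b0000000 ∷ 0b0100000 ∷ 0b1000001
      ∷ 0b0100011 ∷ 0b1000110 ∷ 0b0101011 ∷ 0b0000010 ∷ 0b0100000 ∷ 0b1010000
      ∷ 0b0100010 ∷ 0b1010100 ∷ 0b0000011 ∷ 0b0000011 ∷ []

-- Index 0 is column 4. Past the last code the default 0 gives `false`, and truncated subtraction
-- lets columns further left reuse the first code, so the orientation is defined on the whole grid.
bit : ℕ → ℕ → Bool
bit j i = (fromMaybe 0 (head (drop j codes)) / 2 ^ i) {{ℕ.m^n≢0 2 i}} % 2 ≡ᵇ 1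

-- Both are read at the upper left end of the edge.
right down : ℕ → ℕ → Bool
-- An edge leaving column `c` to the right is stored with column `c + 1`, hence the offset 3 instead
-- of 4.
right r c = bit (c ∸ 3) (r ∸ 1)
down  r c = bit (c ∸ 4) (r + 3)

module Transfer (M : Matrix) where

  directed : Bool → Fin 5 → Fin 5 → Bool
  directed b x y = if b then M [ x , y ] else M [ y , x ]

  link : Bool → Bool → Fin 5 → Fin 5 → Bool
  link e b y y′ = if e then directed b y y′ else true

  link-intro : ∀ e {b y y′} → (T e → T (directed b y y′)) → T (link e b y y′)
  link-intro false h = tt
  link-intro true  h = h tt

  linked : ℕ → ℕ → Fin 5 → Fin 5 → Bool
  linked r c = link ((r + c) % 2 ≡ᵇ 0) (down r c)

  -- Once a row has its new color `y`, its old color constrains nothing further. The subtries of all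
  -- old colors compatible with `y` can thus be merged, so sets of single columns suffice in place
  -- of pairs.
  image : Bool → Vec (Sub n) 5 → Fin 5 → Sub n
  image b Ss y =
    foldr (λ x S → (if directed b x y then Vec.lookup Ss x else ∅) ∪ S) ∅ (allFin 5)

  ∈-image : ∀ {b x y} {xs : Vec (Fin 5) n} Ss → T (directed b x y) →
            xs ∈ₛ Vec.lookup Ss x → xs ∈ₛ image b Ss y
  ∈-image {b = b} {x} {y} {xs} Ss t p = go (∈-allFin x)
    where
    f = λ z → if directed b z y then Vec.lookup Ss z else ∅

    chosen : xs ∈ₛ f x
    chosen with directed b x y
    ... | true = p

    go : ∀ {zs} → x ∈ zs → xs ∈ₛ foldr (λ z S → f z ∪ S) ∅ zs
    go (here refl)          = ∈-∪ˡ chosen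
    go {z ∷ _} (there x∈zs) = ∈-∪ʳ {S = f z} (go x∈zs)

  -- From column c to column c + 1, from row r downwards; ok tells which colors of
  -- row r are compatible with the color just chosen in the row above.
  advance : ℕ → ℕ → (Fin 5 → Bool) → Sub n → Sub n
  branch  : ℕ → ℕ → (Fin 5 → Bool) → Bool → (Fin 5 → Fin 5 → Bool) →
            Vec (Sub n) 5 → Fin 5 → Sub n
  advance r c ok ∅         = ∅
  advance r c ok ε         = ε
  advance r c ok (node Ss) =
    node (tabulate (branch (suc r) c ok (right r c) (linked r (suc c)) Ss))
  branch r c ok b l Ss y = if ok y then advance r c (l y) (image b Ss y) else ∅

  -- Vertical edges are tested in the new column only, those of the old one having been tested a
  -- step earlier. In the starting column they stay unconstrained, which can only add candidates.
  data Fits (c : ℕ) : ℕ → (Fin 5 → Bool) → Vec (Fin 5) n → Vec (Fin 5) n → Set where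
    []  : ∀ {r ok} → Fits c r ok [] []
    fit : ∀ {r ok x y} {xs ys : Vec (Fin 5) n} → T (ok y) → T (directed (right r c) x y) →
          Fits c (suc r) (linked r (suc c) y) xs ys → Fits c r ok (x ∷ xs) (y ∷ ys)

  -- This inclusion says that no coloring is lost, which is what makes an empty set a refutation.
  ∈-advance : ∀ {r c ok} {xs ys : Vec (Fin 5) n} {S} →
              Fits c r ok xs ys → xs ∈ₛ S → ys ∈ₛ advance r c ok S
  ∈-advance [] ε = ε
  ∈-advance {r = r} {c} {ok} (fit {y = y} {ys = ys} t d fits) (node {Ss = Ss} p) =
    node (subst (ys ∈ₛ_) (sym (lookup∘tabulate next y)) (guarded (ok y) t))
    where
    next : Fin 5 → Sub _
    next = branch (suc r) c ok (right r c) (linked r (suc c)) Ss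

    guarded : ∀ b → T b → ys ∈ₛ
      (if b then advance (suc r) c (linked r (suc c) y) (image (right r c) Ss y) else ∅)
    guarded true _ = ∈-advance fits (∈-image Ss d p)

  Follows : ℕ → Vec (Fin 5) n → Vec (Fin 5) n → Set
  Follows c = Fits c 1 (λ _ → true)

  run : ℕ → ℕ → Sub n → Sub n
  run zero    c S = S
  run (suc m) c S = run m (suc c) (advance 1 c (λ _ → true) S)

  ∈-run : ∀ m {c} (xs : Fin (suc m) → Vec (Fin 5) n) {S} →
          (∀ k → Follows (c + toℕ k) (xs (inject₁ k)) (xs (suc k))) →
          xs zero ∈ₛ S → xs (fromℕ m) ∈ₛ run m c S
  ∈-run zero        xs follows p = p
  ∈-run (suc m) {c} xs follows p = ∈-run m (xs ∘ suc)
    (λ k → subst (λ j → Follows j (xs (suc (inject₁ k))) (xs (suc (suc k))))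
                 (ℕ.+-suc c (toℕ k)) (follows (suc k)))
    (∈-advance (subst (λ j → Follows j (xs zero) (xs (suc zero)))
                      (ℕ.+-identityʳ c) (follows zero)) p)

  -- A record, because conversion checking would evaluate run on unfolding it.
  record Extinct (n m c : ℕ) : Set where
    constructor extinct
    field
      empty : ∀ xs → ¬ xs ∈ₛ run m c (full n)

  ¬extinct : ∀ {m c} (xs : Fin (suc m) → Vec (Fin 5) n) →
             (∀ k → Follows (c + toℕ k) (xs (inject₁ k)) (xs (suc k))) → ¬ Extinct n m c
  ¬extinct {m = m} xs follows (extinct empty) =
    empty (xs (fromℕ m)) (∈-run m xs follows (∈-full (xs zero)))

-- Exhaustive check of the standard tournaments

∀-bool? : {P : Bool → Set} → U.Decidable P → Dec (∀ b → P b)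
∀-bool? P? = map′ (λ { (f , t) false → f ; (f , t) true → t }) (λ p → p false , p true)
                  (P? false ×-dec P? true)

extinct? : ∀ n m c → U.Decidable (λ M → Transfer.Extinct M n m c)
extinct? n m c M =
  map′ Transfer.extinct Transfer.Extinct.empty (empty? (Transfer.run M m c (full n)))

-- Proof by evaluation of the decision procedure: 4 rows, one step for each of the 22 codes, the
-- first step leaving column 3.
all-extinct : ∀ p q r s t u → Transfer.Extinct (standard p q r s t u) 4 22 3
all-extinct = toWitness {a? =
  ∀-bool? λ p → ∀-bool? λ q → ∀-bool? λ r → ∀-bool? λ s → ∀-bool? λ t → ∀-bool? λ u →
    extinct? 4 22 3 (standard p q r s t u)} tt

-- An orientation of H₃,₁₂

hexStep-asym : ∀ {m n} → Asymmetric (hexStep {m} {n})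
hexStep-asym s t = squareStep-asym (hexStep⇒squareStep s) (hexStep⇒squareStep t)
  where
  suc-asym : ∀ {i j} → i ≡ suc j → ¬ j ≡ suc i
  suc-asym refl ()

  squareStep-asym : Asymmetric squareStep
  squareStep-asym (inj₁ (_ , p)) (inj₁ (_ , q)) = suc-asym p q
  squareStep-asym (inj₁ (p , _)) (inj₂ (q , _)) = ℕ.1+n≢n (trans (sym q) (sym p))
  squareStep-asym (inj₂ (p , _)) (inj₁ (q , _)) = ℕ.1+n≢n (trans (sym p) (sym q))
  squareStep-asym (inj₂ (p , _)) (inj₂ (q , _)) = suc-asym p q

-- The edge of a step from u to v is directed along the step iff b u v.
module Directions {m n} (b : HexVertex m n → HexVertex m n → Bool) where

  private
    V = HexVertex m n

    Step : V → V → Set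
    Step u v = hexStep (proj₁ u) (proj₁ v)

    step-asym : ∀ {u v} → Step u v → ¬ Step v u
    step-asym {u} {v} = hexStep-asym {x = proj₁ u} {proj₁ v}

  Arc : V → V → Set
  Arc u v = (Step u v × T (b u v)) ⊎ (Step v u × T (not (b v u)))

  step-arc : ∀ {u v} → Step u v → Arc u v ⊎ Arc v u
  step-arc {u} {v} s with b u v
  ... | true  = inj₁ (inj₁ (s , tt))
  ... | false = inj₂ (inj₂ (s , tt))

  asym : Asymmetric Arc
  asym {u} {v} (inj₁ (s , _)) (inj₁ (t , _)) = step-asym {u} {v} s t
  asym {u} {v} (inj₁ (_ , p)) (inj₂ (_ , q)) with b u v
  ... | true = q
  asym {u} {v} (inj₂ (_ , p)) (inj₁ (_ , q)) with b v u
  ... | true = p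
  asym {u} {v} (inj₂ (s , _)) (inj₂ (t , _)) = step-asym {v} {u} s t

  oriented : Orientation (hexGrid m n)
  oriented = record
    { Arc      = Arc
    ; arc⇒edge = λ { (inj₁ (s , _)) → fwd s ; (inj₂ (s , _)) → bwd s }
    ; edge⇒arc = λ { {u} {v} (fwd s) → step-arc {u} {v} s
                   ; {u} {v} (bwd s) → Sum.swap (step-arc {v} {u} s) }
    ; asym     = λ {u} {v} → asym {u} {v}
    }

  -- Both possible directions of an edge become one constraint on its step: `b` decides whether `M`
  -- is read along the step or against it.
  step-directed : ∀ {M} {f : V → Fin 5} → (∀ {u v} → Arc u v → T (M [ f u , f v ])) →
                  ∀ {u v} → Step u v → T (Transfer.directed M (b u v) (f u) (f v))
  step-directed hom {u} {v} s with b u v in eq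
  ... | true  = hom {u} {v} (inj₁ (s , subst T (sym eq) tt))
  ... | false = hom {v} {u} (inj₂ (s , subst (T ∘ not) (sym eq) tt))

direction : ∀ {m n} → Cell m n → Bool → Bool
direction u horizontal = if horizontal then right (row u) (col u) else down (row u) (col u)

-- A step is horizontal exactly when its ends share a row, so comparing rows selects the table to
-- read.
forward : HexVertex 3 12 → HexVertex 3 12 → Bool
forward (u , _) (v , _) = direction u (does (row u ≟ row v))

-- For four rows, the columns meeting all of them are 3 to `2 * n + 1`; 12 is the least `n` that
-- gives the 23 columns required by 22 steps.
open Directions {3} {12} forward

-- The second index stands for the columns 3, …, 25, which meet all four rows.
cell : Fin 4 → Fin 23 → Cell 4 27
cell i k = i , 2 ↑ʳ (k ↑ˡ 2)

col-cell : ∀ i k → col (cell i k) ≡ 3 + toℕ k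
col-cell i k = cong (3 +_) (Fin.toℕ-↑ˡ k 2)

col-inject₁ : ∀ i k → col (cell i (inject₁ k)) ≡ 3 + toℕ k
col-inject₁ i k = trans (col-cell i (inject₁ k)) (cong (3 +_) (Fin.toℕ-inject₁ k))

vertex : Fin 4 → Fin 23 → HexVertex 3 12
vertex i k = cell i k ,
  subst (λ c → toℕ i ≤ c × c ≤ suc (toℕ i) + 24) (sym (col-cell i k))
    -- The lower bound comes from `i ≤ 3`, the upper one from `k ≤ 22`.
    ( ℕ.≤-trans (Fin.toℕ≤pred[n] i) (ℕ.m≤m+n 3 (toℕ k))
    , s≤s (ℕ.≤-trans (s≤s (s≤s (Fin.toℕ≤pred[n] k))) (ℕ.m≤n+m 24 (toℕ i))) )

module Window {M : Matrix} {f : HexVertex 3 12 → Fin 5}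
              (hom : ∀ {u v} → Arc u v → T (M [ f u , f v ])) where
  open Transfer M

  column : Fin 23 → Vec (Fin 5) 4
  column k = tabulate (λ i → f (vertex i k))

  right-directed : ∀ i k → T (directed (right (suc (toℕ i)) (3 + toℕ k))
                                (f (vertex i (inject₁ k))) (f (vertex i (suc k))))
  right-directed i k = subst (λ b → T (directed b (f u) (f v))) forward≡right
    (step-directed {M = M} {f = f} (λ {u} {v} → hom {u} {v}) {u} {v} (inj₁ (refl , col≡)))
    where
    u = vertex i (inject₁ k)
    v = vertex i (suc k)

    col≡ : col (proj₁ v) ≡ suc (col (proj₁ u))
    col≡ = trans (col-cell i (suc k)) (cong suc (sym (col-inject₁ i k)))

    forward≡right : forward u v ≡ right (suc (toℕ i)) (3 + toℕ k)
    forward≡right = trans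
      (cong (direction (proj₁ u)) (dec-true (suc (toℕ i) ≟ suc (toℕ i)) refl))
      (cong (right (suc (toℕ i))) (col-inject₁ i k))

  down-linked : ∀ (i : Fin 3) k → T (linked (suc (toℕ i)) (3 + toℕ k)
                                      (f (vertex (inject₁ i) k)) (f (vertex (suc i) k)))
  down-linked i k = link-intro ((suc (toℕ i) + (3 + toℕ k)) % 2 ≡ᵇ 0) λ even →
    subst (λ b → T (directed b (f u) (f v))) forward≡down
      (step-directed {M = M} {f = f} (λ {u} {v} → hom {u} {v}) {u} {v}
        (inj₂ ((cong suc (cong suc (sym row≡)) , refl) , 2∣row+col even)))
    where
    u = vertex (inject₁ i) k
    v = vertex (suc i) k

    row≡ : toℕ (inject₁ i) ≡ toℕ i
    row≡ = Fin.toℕ-inject₁ i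

    2∣row+col : T ((suc (toℕ i) + (3 + toℕ k)) % 2 ≡ᵇ 0) → 2 ∣ row (proj₁ u) + col (proj₁ u)
    2∣row+col even = subst (2 ∣_) (sym (cong₂ _+_ (cong suc row≡) (col-cell (inject₁ i) k)))
             (m%n≡0⇒n∣m _ 2 (ℕ.≡ᵇ⇒≡ _ 0 even))

    forward≡down : forward u v ≡ down (suc (toℕ i)) (3 + toℕ k)
    forward≡down = trans
      (cong (direction (proj₁ u))
        (dec-false (row (proj₁ u) ≟ row (proj₁ v))
          (λ eq → ℕ.1+n≢n (trans (sym (ℕ.suc-injective eq)) row≡))))
      (cong₂ down (cong suc row≡) (col-cell (inject₁ i) k))

  follows : ∀ k → Follows (3 + toℕ k) (column (inject₁ k)) (column (suc k))
  follows k =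
    -- Row 1 has no row above it; the other rows take their vertical constraint from the new column
    -- `suc k`.
    fit tt                       (right-directed 0F k) (
    fit (down-linked 0F (suc k)) (right-directed 1F k) (
    fit (down-linked 1F (suc k)) (right-directed 2F k) (
    fit (down-linked 2F (suc k)) (right-directed 3F k) [])))

  survives : ¬ Extinct 4 22 3
  survives = ¬extinct column follows

-- Composing the coloring with `π` replaces an arbitrary tournament by a standard matrix, where
-- survival of the window contradicts extinction.
uncolorable : ¬ OrientedColoring oriented 5
uncolorable (K⃗ , h) =
  let p , q , r , s , t , u , π , standard-π = standardize (arc? K⃗) (Orientation.asym K⃗)
  in Window.survives {f = π ∘ Hom.map h} (λ {u} {v} a → standard-π (Hom.arc h {u} {v} a))
       (all-extinct p q r s t u)

⊑-refl : ∀ {G} → G ⊑ G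
⊑-refl = record { embed = λ v → v ; injective = λ eq → eq ; edge = λ e → e }

theorem2 : 6 ≤χₒ ℋ₂
theorem2 = ≤χₒ-intro oriented (subgraph 3 12 ⊑-refl) uncolorable
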